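{- Let $k \ge 3$ and $n \ge 1$ be integers and let $1 \le \rho \le n$. Suppose there exist $k-2$ mutually orthogonal latin squares of order $n$ having a common partial transversal of size $\rho$. Then there exists a $((k-1)n+\rho, k)$-packing with exactly $\rho n + D(\rho,k)$ blocks in which the largest partial parallel class has size $\rho$.
   Context: For integers $v \ge k \ge 2$, a $(v,k)$-packing is a pair $(X,\mathcal{B})$ where $X$ is a set of $v$ points and $\mathcal{B}$ is a set of $k$-subsets of $X$ (blocks) such that every pair of distinct points lies in at most one block. For integers $m \ge 0$, $D(m,k)$ denotes the maximum number of $k$-subsets of an $m$-set such that every pair of points lies in at most one of them (so $D(m,k)=0$ if $m<k$). A partial parallel class (PPC) is a set of pairwise disjoint blocks; its size is the number of blocks. "The largest PPC has size $\rho$" means the packing has a PPC of size $\rho$ but none of size $\rho+1$. A common (partial) transversal of size $\rho$ of a set of latin squares of order $n$ is a set of $\rho$ cells, no two in the same row or the same column, such that in each of the latin squares the symbols in these $\rho$ cells are pairwise distinct. -}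

module Defs where

open import Data.Bool.Properties using () renaming (_≟_ to _≟ᵇ_)
open import Data.Empty using (⊥)
open import Data.Fin.Base using (Fin)
open import Data.Fin.Properties using () renaming (_≟_ to _≟ᶠ_; all? to allᶠ?)
open import Data.Fin.Subset using (Subset; inside; outside; ∣_∣; _∩_; Empty) renaming (_∈_ to _∈ₛ_)
open import Data.Fin.Subset.Properties using () renaming (_∈?_ to _∈ₛ?_)
open import Data.List.Base using (List; []; _∷_; _++_; map; filter; length)
open import Data.List.Extrema.Nat using (argmax; argmax-all; f[xs]≤f[argmax])
open import Data.List.Membership.Propositional using (_∈_)
open import Data.List.Membership.Propositional.Properties
  using (∈-map⁺; ∈-map⁻; ∈-++⁺ˡ; ∈-++⁺ʳ; ∈-filter⁺; ∈-filter⁻)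
open import Data.List.Membership.Propositional.Properties.WithK using (unique∧set⇒bag)
import Data.List.Membership.DecPropositional as DecMembership
open import Data.List.Relation.Binary.Permutation.Propositional.Properties using (↭-length)
open import Data.List.Relation.Binary.BagAndSetEquality using (∼bag⇒↭)
open import Data.List.Relation.Unary.All using (All; []; all?)
import Data.List.Relation.Unary.All as All
open import Data.List.Relation.Unary.All.Properties using (all-filter)
open import Data.List.Relation.Unary.Any using (here)
open import Data.List.Relation.Unary.AllPairs using ([]; _∷_)
open import Data.List.Relation.Unary.Unique.Propositional using (Unique)
open import Data.List.Relation.Unary.Unique.Propositional.Properties
  using () renaming (map⁺ to Unique-map⁺; ++⁺ to Unique-++⁺; filter⁺ to Unique-filter⁺)
import Data.List.Relation.Unary.Unique.DecPropositional as DecUnique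
open import Data.Nat.Base using (ℕ; suc; _≤_)
open import Data.Nat.Properties using (≤-trans; ≤-reflexive) renaming (_≟_ to _≟ⁿ_)
open import Data.Product.Base using (_×_; _,_; proj₁; proj₂; ∃; ∃-syntax)
open import Data.Vec.Base using ([]; _∷_)
open import Data.Vec.Properties using (≡-dec; ∷-injectiveʳ)
open import Function.Base using (_∘_)
open import Function.Bundles using (mk⇔)
open import Function.Definitions using (Bijective)
open import Relation.Binary.Definitions using (DecidableEquality)
open import Relation.Binary.PropositionalEquality using (_≡_; _≢_; refl)
open import Relation.Nullary.Decidable using (Dec; yes; no; map′; _×-dec_; _→-dec_; ¬?)
open import Relation.Nullary.Negation using (¬_)

-- The point set is Fin v. A set of blocks is a duplicate-free list, so that
-- its cardinality is the length of the list.

-- There is no restriction on v and k here, as D below ranges over all m.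
record IsPacking (v k : ℕ) (ℬ : List (Subset v)) : Set where
  field
    unique  : Unique ℬ
    uniform : All (λ B → ∣ B ∣ ≡ k) ℬ
    pairs   : ∀ {x y} → x ≢ y → ∀ {B C} → B ∈ ℬ → C ∈ ℬ →
              x ∈ₛ B → y ∈ₛ B → x ∈ₛ C → y ∈ₛ C → B ≡ C

record Packing (v k : ℕ) : Set where
  field
    2≤k       : 2 ≤ k
    k≤v       : k ≤ v
    blocks    : List (Subset v)
    isPacking : IsPacking v k blocks

  numberOfBlocks : ℕ
  numberOfBlocks = length blocks

record IsPPC {v} (ℬ : List (Subset v)) (𝒫 : List (Subset v)) : Set where
  field
    unique   : Unique 𝒫
    isSubset : ∀ {B} → B ∈ 𝒫 → B ∈ ℬ
    disjoint : ∀ {B C} → B ∈ 𝒫 → C ∈ 𝒫 → B ≢ C → Empty (B ∩ C)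

HasPPCOfSize : ∀ {v k} → Packing v k → ℕ → Set
HasPPCOfSize P s = ∃[ 𝒫 ] IsPPC (Packing.blocks P) 𝒫 × length 𝒫 ≡ s

LargestPPCHasSize : ∀ {v k} → Packing v k → ℕ → Set
LargestPPCHasSize P ρ = HasPPCOfSize P ρ × ¬ HasPPCOfSize P (suc ρ)

IsMaximumPackingSize : (m k d : ℕ) → Set
IsMaximumPackingSize m k d =
  (∃[ ℬ ] IsPacking m k ℬ × length ℬ ≡ d) ×
  (∀ ℬ → IsPacking m k ℬ → length ℬ ≤ d)

private
  _≟ₛ_ : ∀ {n} → DecidableEquality (Subset n)
  _≟ₛ_ = ≡-dec _≟ᵇ_

  isPacking? : ∀ v k (ℬ : List (Subset v)) → Dec (IsPacking v k ℬ)
  isPacking? v k ℬ = map′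
    (λ (u , s , p) → record
      { unique  = u
      ; uniform = s
      ; pairs   = λ {x} {y} x≢y B∈ C∈ → All.lookup (All.lookup (p x y x≢y) B∈) C∈
      })
    (λ q → IsPacking.unique q , IsPacking.uniform q , λ x y x≢y →
      All.tabulate λ B∈ → All.tabulate λ C∈ → IsPacking.pairs q x≢y B∈ C∈)
    (DecUnique.unique? _≟ₛ_ ℬ
      ×-dec all? (λ B → ∣ B ∣ ≟ⁿ k) ℬ
      ×-dec allᶠ? λ x → allᶠ? λ y → ¬? (x ≟ᶠ y) →-dec
        all? (λ B → all? (λ C →
          (x ∈ₛ? B) →-dec (y ∈ₛ? B) →-dec (x ∈ₛ? C) →-dec (y ∈ₛ? C) →-dec (B ≟ₛ C)) ℬ) ℬ)

  subsets : ∀ n → List (Subset n)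
  subsets 0       = [] ∷ []
  subsets (suc n) = map (inside ∷_) (subsets n) ++ map (outside ∷_) (subsets n)

  ∈-subsets : ∀ {n} (B : Subset n) → B ∈ subsets n
  ∈-subsets []            = here refl
  ∈-subsets (inside  ∷ B) = ∈-++⁺ˡ (∈-map⁺ (inside ∷_) (∈-subsets B))
  ∈-subsets (outside ∷ B) = ∈-++⁺ʳ _ (∈-map⁺ (outside ∷_) (∈-subsets B))

  subsets-unique : ∀ n → Unique (subsets n)
  subsets-unique 0       = [] ∷ []
  subsets-unique (suc n) = Unique-++⁺
    (Unique-map⁺ ∷-injectiveʳ (subsets-unique n))
    (Unique-map⁺ ∷-injectiveʳ (subsets-unique n))
    (λ (i , o) → clash (∈-map⁻ (inside ∷_) i) (∈-map⁻ (outside ∷_) o))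
    where
    clash : ∀ {B : Subset (suc n)} →
            ∃ (λ C → C ∈ subsets n × B ≡ inside ∷ C) →
            ∃ (λ C → C ∈ subsets n × B ≡ outside ∷ C) → ⊥
    clash (_ , _ , refl) (_ , _ , ())

  sublists : ∀ {A : Set} → List A → List (List A)
  sublists []       = [] ∷ []
  sublists (x ∷ xs) = map (x ∷_) (sublists xs) ++ sublists xs

  filter-∈-sublists : ∀ {A : Set} {P : A → Set} (P? : ∀ x → Dec (P x)) xs →
                      filter P? xs ∈ sublists xs
  filter-∈-sublists P? []       = here refl
  filter-∈-sublists P? (x ∷ xs) with P? x
  ... | yes _ = ∈-++⁺ˡ (∈-map⁺ (x ∷_) (filter-∈-sublists P? xs))
  ... | no  _ = ∈-++⁺ʳ _ (filter-∈-sublists P? xs)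

maximumPackingSize : ∀ m k → ∃ (IsMaximumPackingSize m k)
maximumPackingSize m k = length best , (best , best-isPacking , refl) , best-max
  where
  candidates : List (List (Subset m))
  candidates = filter (isPacking? m k) (sublists (subsets m))

  best : List (Subset m)
  best = argmax length [] candidates

  best-isPacking : IsPacking m k best
  best-isPacking = argmax-all length
    (record { unique = [] ; uniform = [] ; pairs = λ _ () })
    (all-filter (isPacking? m k) (sublists (subsets m)))

  best-max : ∀ ℬ → IsPacking m k ℬ → length ℬ ≤ length best
  best-max ℬ p = ≤-trans
    (≤-reflexive (↭-length (∼bag⇒↭ (unique∧set⇒bag P.unique 𝒞-unique (mk⇔ to from)))))
    (All.lookup (f[xs]≤f[argmax] {f = length} [] candidates)
      (∈-filter⁺ (isPacking? m k) (filter-∈-sublists ∈ℬ? (subsets m)) 𝒞-isPacking))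
    where
    module P = IsPacking p
    ∈ℬ? : ∀ B → Dec (B ∈ ℬ)
    ∈ℬ? B = DecMembership._∈?_ _≟ₛ_ B ℬ
    𝒞 : List (Subset m)
    𝒞 = filter ∈ℬ? (subsets m)
    𝒞-unique : Unique 𝒞
    𝒞-unique = Unique-filter⁺ ∈ℬ? (subsets-unique m)
    to : ∀ {B} → B ∈ ℬ → B ∈ 𝒞
    to B∈ = ∈-filter⁺ ∈ℬ? (∈-subsets _) B∈
    from : ∀ {B} → B ∈ 𝒞 → B ∈ ℬ
    from = proj₂ ∘ ∈-filter⁻ ∈ℬ? {xs = subsets m}
    𝒞-isPacking : IsPacking m k 𝒞
    𝒞-isPacking = record
      { unique  = 𝒞-unique
      ; uniform = All.tabulate (All.lookup P.uniform ∘ from)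
      ; pairs   = λ x≢y B∈ C∈ → P.pairs x≢y (from B∈) (from C∈)
      }

D : ℕ → ℕ → ℕ
D m k = proj₁ (maximumPackingSize m k)

D-isMaximum : ∀ m k → IsMaximumPackingSize m k (D m k)
D-isMaximum m k = proj₂ (maximumPackingSize m k)

-- An n × n array of symbols from Fin n, as row ↦ column ↦ symbol.
Square : ℕ → Set
Square n = Fin n → Fin n → Fin n

-- Every symbol occurs exactly once in each row and exactly once in each column.
record IsLatin {n} (L : Square n) : Set where
  field
    rows    : ∀ i → Bijective _≡_ _≡_ (λ j → L i j)
    columns : ∀ j → Bijective _≡_ _≡_ (λ i → L i j)

-- Every ordered pair of symbols occurs in exactly one cell of the superposition.
Orthogonal : ∀ {n} → Square n → Square n → Set
Orthogonal {n} L M =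
  Bijective {A = Fin n × Fin n} {B = Fin n × Fin n} _≡_ _≡_ (λ (i , j) → L i j , M i j)

-- An indexed family rather than a set of squares: for n = 1 there is only one
-- latin square, and it then occurs t times.
record MOLS (t n : ℕ) : Set where
  field
    square     : Fin t → Square n
    latin      : ∀ s → IsLatin (square s)
    orthogonal : ∀ s u → s ≢ u → Orthogonal (square s) (square u)

-- Cells are pairs (row , column); distinctness of the rows already makes the
-- cells themselves distinct.
record IsCommonPartialTransversal {t n} (L : Fin t → Square n) (ρ : ℕ)
                                  (cells : List (Fin n × Fin n)) : Set where
  field
    size    : length cells ≡ ρ
    rows    : Unique (map proj₁ cells)
    columns : Unique (map proj₂ cells)
    symbols : ∀ s → Unique (map (λ (i , j) → L s i j) cells)

HasCommonPartialTransversal : ∀ {t n} → MOLS t n → ℕ → Set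
HasCommonPartialTransversal M ρ = ∃[ cells ] IsCommonPartialTransversal (MOLS.square M) ρ cells

{-# OPTIONS --safe #-}
module Submission where

-- The squares give a transversal design with k groups of size n (rows, columns
-- and one group of symbols per square), whose blocks are the cells. Delete the
-- rows that the transversal misses, keep the ρ n blocks through the remaining
-- ρ rows (the stem), and add a maximum packing of blocks inside the stem. Every
-- block meets the stem, so a parallel class has at most ρ blocks, and the cells
-- of the transversal form one of size ρ.

open import Defs
open import Data.Nat.Base using (ℕ; _+_; _*_; _∸_; _≤_)
open import Data.Product.Base using (Σ; _×_)
open import Relation.Binary.PropositionalEquality using (_≡_)

open import Data.Fin.Base using (Fin; zero; suc; _<_; _↑ˡ_; _↑ʳ_; combine; splitAt; remQuot)
open import Data.Fin.Properties
  using (<-cmp; pigeonhole; remQuot-combine; combine-remQuot;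
         splitAt-↑ˡ; splitAt-↑ʳ; splitAt⁻¹-↑ˡ; splitAt⁻¹-↑ʳ)
open import Data.Fin.Subset
  using (Subset; inside; outside; ∣_∣; _∩_; ⁅_⁆; ⊥; Nonempty) renaming (_∈_ to _∈ₛ_; _∉_ to _∉ₛ_)
open import Data.Fin.Subset.Properties
  using (x∈⁅x⁆; x∈⁅y⁆⇒x≡y; ∣⁅x⁆∣≡1; ∣⊥∣≡0; ∉⊥; nonempty?; Empty-unique; x∈p∩q⁺; x∈p∩q⁻)
open import Data.List.Base as List using (List; length; map)
open import Data.List.Membership.Propositional using (_∈_)
open import Data.List.Membership.Propositional.Properties
  using (∈-++⁺ˡ; ∈-++⁻; ∈-map⁻; ∈-tabulate⁺; ∈-tabulate⁻; ∈-lookup)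
open import Data.List.Properties using (length-++; length-map; length-tabulate)
open import Data.List.Relation.Unary.All as All using (_∷_)
open import Data.List.Relation.Unary.AllPairs using (AllPairs; _∷_)
open import Data.List.Relation.Unary.AllPairs.Properties using (map⁻)
open import Data.List.Relation.Unary.Unique.Propositional using (Unique)
open import Data.List.Relation.Unary.Unique.Propositional.Properties using (map⁺; ++⁺; tabulate⁺)
open import Data.Nat.Base using (suc; z≤n; s≤s; >-nonZero)
open import Data.Nat.Properties using (≤-reflexive; ≤-trans; +-comm; +-mono-≤; m≤m*n; ≮⇒≥; 1+n≰n)
open import Data.Product.Base using (_,_; proj₁; proj₂; ∃-syntax; uncurry)
open import Data.Product.Properties using (,-injective)
open import Data.Sum.Base using (inj₁; inj₂)
open import Data.Vec.Base using ([]; _∷_; _++_; concat; tabulate; lookup)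
open import Data.Vec.Properties
  using ([]=⇒lookup; lookup⇒[]=; lookup-++ˡ; lookup-++ʳ; lookup-concat; lookup∘tabulate; ++-injectiveʳ)
open import Function.Base using (id; _∘_)
open import Function.Definitions using (Injective)
open import Level using (Level)
open import Relation.Binary.Core using (Rel)
open import Relation.Binary.Definitions using (tri<; tri≈; tri>)
open import Relation.Binary.PropositionalEquality
  using (_≢_; refl; sym; trans; cong; cong₂; subst)
open import Relation.Nullary.Decidable using (yes; no)
open import Relation.Nullary.Negation using (¬_; contradiction)

private
  variable
    a b ℓ : Level
    A : Set a
    B : Set b
    m n : ℕ

-- Duplicate-free lists and injective indexings.

AllPairs-lookup : ∀ {R : Rel A ℓ} {xs} → AllPairs R xs →
                  ∀ {i j} → i < j → R (List.lookup xs i) (List.lookup xs j)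
AllPairs-lookup (x~xs ∷ _) {zero}  {suc j} _         = All.lookup x~xs (∈-lookup j)
AllPairs-lookup (_ ∷ xs~)  {suc i} {suc j} (s≤s i<j) = AllPairs-lookup xs~ i<j

-- Distinctness of the rows, columns or symbols of the transversal becomes injectivity in the index
-- of its cells. `AllPairs` relates only an earlier entry to a later one, hence the trichotomy.
Unique-map⇒lookup-injective : ∀ (f : A → B) {xs} → Unique (map f xs) →
                              Injective _≡_ _≡_ (f ∘ List.lookup xs)
Unique-map⇒lookup-injective f unique {i} {j} eq with <-cmp i j
... | tri< i<j _ _  = contradiction eq (AllPairs-lookup (map⁻ unique) i<j)
... | tri≈ _ i≡j _  = i≡j
... | tri> _ _ j<i  = contradiction (sym eq) (AllPairs-lookup (map⁻ unique) j<i)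

remQuot-injective : ∀ m {n} → Injective _≡_ _≡_ (remQuot {m} n)
remQuot-injective m {n} {x} {y} eq = trans (sym (combine-remQuot {m} n x))
  (trans (cong (uncurry combine) eq) (combine-remQuot {m} n y))

-- Subsets as boolean vectors, graphs of functions, and a bound for disjoint blocks.

lookup-≡⇒∈ : ∀ {p : Subset m} {q : Subset n} {x y} →
             lookup p x ≡ lookup q y → x ∈ₛ p → y ∈ₛ q
lookup-≡⇒∈ eq x∈p = lookup⇒[]= _ _ (trans (sym eq) ([]=⇒lookup x∈p))

∣p∣≢0⇒Nonempty : ∀ {p : Subset n} → ∣ p ∣ ≢ 0 → Nonempty p
∣p∣≢0⇒Nonempty {n} {p} ∣p∣≢0 with nonempty? p
... | yes nonempty = nonempty
... | no  empty    = contradiction (trans (cong ∣_∣ (Empty-unique empty)) (∣⊥∣≡0 n)) ∣p∣≢0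

∣p++q∣≡∣p∣+∣q∣ : ∀ (p : Subset m) (q : Subset n) → ∣ p ++ q ∣ ≡ ∣ p ∣ + ∣ q ∣
∣p++q∣≡∣p∣+∣q∣ []            q = refl
∣p++q∣≡∣p∣+∣q∣ (inside  ∷ p) q = cong suc (∣p++q∣≡∣p∣+∣q∣ p q)
∣p++q∣≡∣p∣+∣q∣ (outside ∷ p) q = ∣p++q∣≡∣p∣+∣q∣ p q

-- The pairs in `Fin m × Fin n` are numbered by `combine`, so the graph consists of `m` consecutive
-- segments of length `n`, each a singleton.
graph : (Fin m → Fin n) → Subset (m * n)
graph f = concat (tabulate (⁅_⁆ ∘ f))

∣graph∣ : ∀ (f : Fin m → Fin n) → ∣ graph f ∣ ≡ m
∣graph∣ {0}     f = refl
∣graph∣ {suc m} f = trans (∣p++q∣≡∣p∣+∣q∣ ⁅ f zero ⁆ _)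
  (cong₂ _+_ (∣⁅x⁆∣≡1 (f zero)) (∣graph∣ (f ∘ suc)))

lookup-graph : ∀ (f : Fin m → Fin n) g i → lookup (graph f) (combine g i) ≡ lookup ⁅ f g ⁆ i
lookup-graph f g i = trans (lookup-concat (tabulate (⁅_⁆ ∘ f)) g i)
  (cong (λ p → lookup p i) (lookup∘tabulate (⁅_⁆ ∘ f) g))

-- Pigeonhole: among more than `ρ` blocks, two distinct ones would be assigned the same `a`, and so
-- would share `point a`.
PPC-bound : ∀ {v ρ} {ℬ 𝒫 : List (Subset v)} (point : Fin ρ → Fin v) →
            (∀ {B} → B ∈ ℬ → ∃[ a ] point a ∈ₛ B) → IsPPC ℬ 𝒫 → length 𝒫 ≤ ρ
PPC-bound {ρ = ρ} {𝒫 = 𝒫} point meets ppc = ≮⇒≥ λ ρ<∣𝒫∣ →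
  let i , j , i<j , eq = pigeonhole ρ<∣𝒫∣ (proj₁ ∘ met)
  in disjoint (∈-lookup i) (∈-lookup j) (AllPairs-lookup unique i<j)
       (_ , x∈p∩q⁺ (proj₂ (met i) , subst (λ a → point a ∈ₛ List.lookup 𝒫 j) (sym eq) (proj₂ (met j))))
  where
  open IsPPC ppc
  met : ∀ i → ∃[ a ] point a ∈ₛ List.lookup 𝒫 i
  met i = meets (isSubset (∈-lookup i))

-- Coordinates on the point set.

-- The points are (g , i) in Fin m × Fin n, grouped by g, and the stem Fin ρ.
module Points (m n ρ : ℕ) where

  grouped : Fin m → Fin n → Fin (m * n + ρ)
  grouped g i = combine g i ↑ˡ ρ

  stem : Fin ρ → Fin (m * n + ρ)
  stem = (m * n) ↑ʳ_

  -- Matching on a view replaces a raw index by its coordinates; every question about which points a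
  -- block contains is then settled separately on the groups and on the stem.
  data View : Fin (m * n + ρ) → Set where
    isGrouped : ∀ g i → View (grouped g i)
    isStem    : ∀ a → View (stem a)

  view : ∀ x → View x
  view x with splitAt (m * n) x in eq
  ... | inj₁ y = subst View
    (trans (cong (_↑ˡ ρ) (combine-remQuot {m} n y)) (splitAt⁻¹-↑ˡ eq))
    (uncurry isGrouped (remQuot {m} n y))
  ... | inj₂ a = subst View (splitAt⁻¹-↑ʳ {m * n} eq) (isStem a)

  stem≢grouped : ∀ {a g i} → stem a ≢ grouped g i
  stem≢grouped {a} {g} {i} eq with () ← trans (sym (splitAt-↑ʳ (m * n) ρ a))
    (trans (cong (splitAt (m * n)) eq) (splitAt-↑ˡ (m * n) (combine g i) ρ))

  onStem : Subset ρ → Subset (m * n + ρ)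
  onStem p = ⊥ {m * n} ++ p

  grouped∉onStem : ∀ p g i → grouped g i ∉ₛ onStem p
  grouped∉onStem p g i = ∉⊥ {x = combine g i} ∘ lookup-≡⇒∈ (lookup-++ˡ ⊥ p (combine g i))

  stem∈onStem⁺ : ∀ {p a} → a ∈ₛ p → stem a ∈ₛ onStem p
  stem∈onStem⁺ {p} {a} = lookup-≡⇒∈ (sym (lookup-++ʳ (⊥ {m * n}) p a))

  stem∈onStem⁻ : ∀ {p a} → stem a ∈ₛ onStem p → a ∈ₛ p
  stem∈onStem⁻ {p} {a} = lookup-≡⇒∈ (lookup-++ʳ (⊥ {m * n}) p a)

  onStem-injective : Injective _≡_ _≡_ onStem
  onStem-injective = ++-injectiveʳ (⊥ {m * n}) ⊥

  ∣onStem∣ : ∀ p → ∣ onStem p ∣ ≡ ∣ p ∣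
  ∣onStem∣ p = trans (∣p++q∣≡∣p∣+∣q∣ (⊥ {m * n}) p) (cong (_+ ∣ p ∣) (∣⊥∣≡0 (m * n)))

-- Blocks of the truncated transversal design.

-- entry g a j is the point in which the block of the cell in row a and column j meets group g.
module Construction {m n ρ : ℕ} (entry : Fin (suc m) → Fin ρ → Fin n → Fin n)
  (row-injective  : ∀ g a → Injective _≡_ _≡_ (entry g a))
  (pair-injective : ∀ {g h} → g ≢ h → ∀ {a j b l} →
                    entry g a j ≡ entry g b l → entry h a j ≡ entry h b l → a ≡ b × j ≡ l)
  {𝒟 : List (Subset ρ)} (𝒟-isPacking : IsPacking ρ (suc (suc m)) 𝒟) where

  open Points (suc m) n ρ
  private module 𝒟 = IsPacking 𝒟-isPacking

  -- The retained rows are the stem, so the row of a cell contributes the final singleton and the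
  -- graph covers the other groups.
  block : Fin ρ × Fin n → Subset (suc m * n + ρ)
  block (a , j) = graph (λ g → entry g a j) ++ ⁅ a ⁆

  lookup-block-grouped : ∀ c g i →
    lookup (block c) (grouped g i) ≡ lookup ⁅ uncurry (entry g) c ⁆ i
  lookup-block-grouped (a , j) g i = trans
    (lookup-++ˡ (graph (λ g → entry g a j)) ⁅ a ⁆ (combine g i))
    (lookup-graph (λ g → entry g a j) g i)

  lookup-block-stem : ∀ c b → lookup (block c) (stem b) ≡ lookup ⁅ proj₁ c ⁆ b
  lookup-block-stem (a , j) = lookup-++ʳ (graph (λ g → entry g a j)) ⁅ a ⁆

  grouped∈block⁺ : ∀ c g → grouped g (uncurry (entry g) c) ∈ₛ block c
  grouped∈block⁺ c g = lookup-≡⇒∈ (sym (lookup-block-grouped c g _)) (x∈⁅x⁆ (uncurry (entry g) c))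

  grouped∈block⁻ : ∀ c {g i} → grouped g i ∈ₛ block c → i ≡ uncurry (entry g) c
  grouped∈block⁻ c {g} {i} = x∈⁅y⁆⇒x≡y _ ∘ lookup-≡⇒∈ (lookup-block-grouped c g i)

  stem∈block⁺ : ∀ c → stem (proj₁ c) ∈ₛ block c
  stem∈block⁺ c = lookup-≡⇒∈ (sym (lookup-block-stem c _)) (x∈⁅x⁆ (proj₁ c))

  stem∈block⁻ : ∀ c {b} → stem b ∈ₛ block c → b ≡ proj₁ c
  stem∈block⁻ c {b} = x∈⁅y⁆⇒x≡y _ ∘ lookup-≡⇒∈ (lookup-block-stem c b)

  ∣block∣ : ∀ c → ∣ block c ∣ ≡ suc (suc m)
  ∣block∣ (a , j) = trans (∣p++q∣≡∣p∣+∣q∣ (graph (λ g → entry g a j)) ⁅ a ⁆)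
    (trans (cong₂ _+_ (∣graph∣ (λ g → entry g a j)) (∣⁅x⁆∣≡1 a)) (+-comm (suc m) 1))

  -- A cell block has one stem point, so two distinct common points are either a stem point and a
  -- grouped one, which fix the row and then the column, or points in different groups, where
  -- `pair-injective` applies.
  cell-unique : ∀ {x y} → x ≢ y → ∀ c d →
                x ∈ₛ block c → y ∈ₛ block c → x ∈ₛ block d → y ∈ₛ block d → c ≡ d
  cell-unique {x} {y} x≢y c@(a , j) d@(b , l) x∈c y∈c x∈d y∈d with view x | view y
  ... | isStem _ | isStem _ =
    contradiction (cong stem (trans (stem∈block⁻ c x∈c) (sym (stem∈block⁻ c y∈c)))) x≢y
  ... | isStem _ | isGrouped g i
    with refl ← stem∈block⁻ c x∈c | refl ← stem∈block⁻ d x∈d =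
    cong (a ,_) (row-injective g a
      (trans (sym (grouped∈block⁻ c y∈c)) (grouped∈block⁻ d y∈d)))
  ... | isGrouped g i | isStem _
    with refl ← stem∈block⁻ c y∈c | refl ← stem∈block⁻ d y∈d =
    cong (a ,_) (row-injective g a
      (trans (sym (grouped∈block⁻ c x∈c)) (grouped∈block⁻ d x∈d)))
  ... | isGrouped g i | isGrouped h i′ = uncurry (cong₂ _,_) (pair-injective g≢h
    (trans (sym (grouped∈block⁻ c x∈c)) (grouped∈block⁻ d x∈d))
    (trans (sym (grouped∈block⁻ c y∈c)) (grouped∈block⁻ d y∈d)))
    where
    g≢h : g ≢ h
    g≢h refl = x≢y (cong (grouped g)
      (trans (grouped∈block⁻ c {g} x∈c) (sym (grouped∈block⁻ c {g} y∈c))))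

  -- There are `suc m` groups, so group `zero` exists: a cell block meets it, a stem block does not.
  block≢onStem : ∀ c {p} → block c ≢ onStem p
  block≢onStem c {p} eq = grouped∉onStem p zero (uncurry (entry zero) c)
    (subst (_ ∈ₛ_) eq (grouped∈block⁺ c zero))

  -- The stem point and the point in group `zero` are two distinct points common to both blocks.
  block-injective : Injective _≡_ _≡_ block
  block-injective {c} {d} eq = cell-unique (stem≢grouped {proj₁ c} {zero})
    c d (stem∈block⁺ c) (grouped∈block⁺ c zero)
    (subst (_ ∈ₛ_) eq (stem∈block⁺ c)) (subst (_ ∈ₛ_) eq (grouped∈block⁺ c zero))

  -- The packing: cell blocks and stem blocks.

  cellBlocks stemBlocks blocks : List (Subset (suc m * n + ρ))
  -- Indexing the cells by `Fin (ρ * n)` makes the count `ρ * n` immediate.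
  cellBlocks = List.tabulate (block ∘ remQuot {ρ} n)
  stemBlocks = map onStem 𝒟
  blocks     = cellBlocks List.++ stemBlocks

  length-blocks : length blocks ≡ ρ * n + length 𝒟
  length-blocks = trans (length-++ cellBlocks)
    (cong₂ _+_ (length-tabulate (block ∘ remQuot {ρ} n)) (length-map onStem 𝒟))

  data Block : Subset (suc m * n + ρ) → Set where
    cellBlock : ∀ c → Block (block c)
    stemBlock : ∀ {p} → p ∈ 𝒟 → Block (onStem p)

  ∈-blocks⁻ : ∀ {B} → B ∈ blocks → Block B
  ∈-blocks⁻ B∈ with ∈-++⁻ cellBlocks B∈
  ... | inj₁ B∈cells with _ , refl ← ∈-tabulate⁻ B∈cells         = cellBlock _
  ... | inj₂ B∈stems with _ , p∈𝒟 , refl ← ∈-map⁻ onStem B∈stems = stemBlock p∈𝒟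

  block∈blocks : ∀ c → block c ∈ blocks
  block∈blocks (a , j) = ∈-++⁺ˡ (subst (_∈ cellBlocks) (cong block (remQuot-combine a j))
    (∈-tabulate⁺ {f = block ∘ remQuot {ρ} n} (combine a j)))

  ∣Block∣ : ∀ {B} → Block B → ∣ B ∣ ≡ suc (suc m)
  ∣Block∣ (cellBlock c)   = ∣block∣ c
  ∣Block∣ (stemBlock p∈𝒟) = trans (∣onStem∣ _) (All.lookup 𝒟.uniform p∈𝒟)

  -- Stem blocks contain stem points only, and a cell block contains just one of those.
  cell-stem-meet : ∀ {x y} → x ≢ y → ∀ c {p} →
                   x ∈ₛ block c → y ∈ₛ block c → x ∈ₛ onStem p → y ∉ₛ onStem p
  cell-stem-meet {x} {y} x≢y c {p} x∈c y∈c x∈p y∈p with view x | view y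
  ... | isGrouped g i | _             = grouped∉onStem p g i x∈p
  ... | isStem _      | isGrouped g i = grouped∉onStem p g i y∈p
  ... | isStem _      | isStem _      =
    x≢y (cong stem (trans (stem∈block⁻ c x∈c) (sym (stem∈block⁻ c y∈c))))

  stem-pairs : ∀ {x y} → x ≢ y → ∀ {p q} → p ∈ 𝒟 → q ∈ 𝒟 →
               x ∈ₛ onStem p → y ∈ₛ onStem p → x ∈ₛ onStem q → y ∈ₛ onStem q → p ≡ q
  stem-pairs {x} {y} x≢y {p} p∈ q∈ x∈p y∈p x∈q y∈q with view x | view y
  ... | isGrouped g i | _             = contradiction x∈p (grouped∉onStem p g i)
  ... | isStem _      | isGrouped g i = contradiction y∈p (grouped∉onStem p g i)
  ... | isStem _      | isStem _      = 𝒟.pairs (x≢y ∘ cong stem) p∈ q∈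
    (stem∈onStem⁻ x∈p) (stem∈onStem⁻ y∈p) (stem∈onStem⁻ x∈q) (stem∈onStem⁻ y∈q)

  Block-pairs : ∀ {x y} → x ≢ y → ∀ {B C} → Block B → Block C →
                x ∈ₛ B → y ∈ₛ B → x ∈ₛ C → y ∈ₛ C → B ≡ C
  Block-pairs x≢y (cellBlock c) (cellBlock d) x∈B y∈B x∈C y∈C =
    cong block (cell-unique x≢y c d x∈B y∈B x∈C y∈C)
  Block-pairs x≢y (cellBlock c) (stemBlock _) x∈B y∈B x∈C y∈C =
    contradiction y∈C (cell-stem-meet x≢y c x∈B y∈B x∈C)
  Block-pairs x≢y (stemBlock _) (cellBlock d) x∈B y∈B x∈C y∈C =
    contradiction y∈B (cell-stem-meet x≢y d x∈C y∈C x∈B)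
  Block-pairs x≢y (stemBlock p) (stemBlock q) x∈B y∈B x∈C y∈C =
    cong onStem (stem-pairs x≢y p q x∈B y∈B x∈C y∈C)

  blocks-isPacking : IsPacking (suc m * n + ρ) (suc (suc m)) blocks
  blocks-isPacking = record
    { unique  = ++⁺ (tabulate⁺ (remQuot-injective ρ ∘ block-injective))
                    (map⁺ onStem-injective 𝒟.unique) disjoint
    ; uniform = All.tabulate (∣Block∣ ∘ ∈-blocks⁻)
    ; pairs   = λ x≢y B∈ C∈ → Block-pairs x≢y (∈-blocks⁻ B∈) (∈-blocks⁻ C∈)
    }
    where
    disjoint : ∀ {B} → ¬ (B ∈ cellBlocks × B ∈ stemBlocks)
    disjoint (B∈cells , B∈stems)
      with _ , refl ← ∈-tabulate⁻ B∈cells | _ , _ , eq ← ∈-map⁻ onStem B∈stems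
      = block≢onStem _ eq

  -- Partial parallel classes of the packing.

  Block-meets-stem : ∀ {B} → Block B → ∃[ a ] stem a ∈ₛ B
  Block-meets-stem (cellBlock c) = proj₁ c , stem∈block⁺ c
  Block-meets-stem (stemBlock p∈𝒟)
    -- The size of `p` is `suc (suc m)`, so `p` is nonempty.
    with a , a∈p ← ∣p∣≢0⇒Nonempty (λ ∣p∣≡0 →
      contradiction (trans (sym (All.lookup 𝒟.uniform p∈𝒟)) ∣p∣≡0) λ ())
    = a , stem∈onStem⁺ a∈p

  PPC-size≤ρ : ∀ {𝒫} → IsPPC blocks 𝒫 → length 𝒫 ≤ ρ
  PPC-size≤ρ = PPC-bound stem (Block-meets-stem ∘ ∈-blocks⁻)

  module _ (column : Fin ρ → Fin n)
           (column-injective : ∀ g {a b} →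
             entry g a (column a) ≡ entry g b (column b) → a ≡ b) where

    parallelBlock : Fin ρ → Subset (suc m * n + ρ)
    parallelBlock a = block (a , column a)

    -- A shared stem point is the row index of both blocks; for a shared point in group `g`, the
    -- transversal property `column-injective g` identifies the indices.
    parallelBlocks-meet : ∀ {x a b} → x ∈ₛ parallelBlock a → x ∈ₛ parallelBlock b → a ≡ b
    parallelBlocks-meet {x} {a} {b} x∈a x∈b with view x
    ... | isStem _      =
      trans (sym (stem∈block⁻ (a , column a) x∈a)) (stem∈block⁻ (b , column b) x∈b)
    ... | isGrouped g _ = column-injective g
      (trans (sym (grouped∈block⁻ (a , column a) x∈a)) (grouped∈block⁻ (b , column b) x∈b))

    parallelBlocks-isPPC : IsPPC blocks (List.tabulate parallelBlock)
    parallelBlocks-isPPC = record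
      { unique   = tabulate⁺ (cong proj₁ ∘ block-injective)
      ; isSubset = subset
      ; disjoint = disjoint
      }
      where
      subset : ∀ {B} → B ∈ List.tabulate parallelBlock → B ∈ blocks
      subset B∈ with _ , refl ← ∈-tabulate⁻ B∈ = block∈blocks _
      disjoint : ∀ {B C} → B ∈ List.tabulate parallelBlock → C ∈ List.tabulate parallelBlock →
                 B ≢ C → ¬ Nonempty (B ∩ C)
      disjoint B∈ C∈ B≢C (_ , x∈)
        with _ , refl ← ∈-tabulate⁻ B∈ | _ , refl ← ∈-tabulate⁻ C∈
        with x∈B , x∈C ← x∈p∩q⁻ _ _ x∈ = B≢C (cong parallelBlock (parallelBlocks-meet x∈B x∈C))

-- From orthogonal latin squares and a transversal to the packing.

theorem5p1 : (k n ρ : ℕ) → 3 ≤ k → 1 ≤ n → 1 ≤ ρ → ρ ≤ n →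
    Σ (MOLS (k ∸ 2) n) (λ M → HasCommonPartialTransversal M ρ) →
    Σ (Packing ((k ∸ 1) * n + ρ) k) (λ P →
    (Packing.numberOfBlocks P ≡ ρ * n + D ρ k) × LargestPPCHasSize P ρ)
-- With `k = t + 3` there are `t + 1` squares and `t + 2` groups. Matching `size` with `refl` turns
-- `ρ` into `length cells`, so stem points are indices of transversal cells.
theorem5p1 (suc (suc (suc t))) n _ (s≤s (s≤s (s≤s z≤n))) 1≤n 1≤ρ _
  (M , cells , record { size = refl ; rows = rows ; columns = columns ; symbols = symbols }) =
  record { 2≤k = s≤s (s≤s z≤n) ; k≤v = k≤v ; blocks = blocks ; isPacking = blocks-isPacking } ,
  trans length-blocks (cong (ρ * n +_) (proj₂ (proj₂ maximal))) ,
  (_ , parallelBlocks-isPPC column column-injective ,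
   length-tabulate (parallelBlock column column-injective)) ,
  λ (_ , ppc , eq) → 1+n≰n (subst (_≤ ρ) eq (PPC-size≤ρ ppc))
  where
  open MOLS M

  ρ : ℕ
  ρ = length cells

  row column : Fin ρ → Fin n
  row    = proj₁ ∘ List.lookup cells
  column = proj₂ ∘ List.lookup cells

  row-inj : Injective _≡_ _≡_ row
  row-inj = Unique-map⇒lookup-injective proj₁ rows

  -- Group `zero` holds the columns and group `suc s` the symbols of square `s`; stem index `a`
  -- stands for the row of the `a`-th transversal cell.
  entry : Fin (suc (suc t)) → Fin ρ → Fin n → Fin n
  entry zero    _ j = j
  entry (suc s) a j = square s (row a) j

  row-injective : ∀ g a → Injective _≡_ _≡_ (entry g a)
  row-injective zero    _ = id
  row-injective (suc s) a = proj₁ (IsLatin.rows (latin s) (row a))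

  -- A column and a symbol determine the row by the latin property; symbols in two squares determine
  -- the cell by orthogonality. Then `row-inj` passes from equal rows to equal stem indices.
  pair-injective : ∀ {g h} → g ≢ h → ∀ {a j b l} →
                   entry g a j ≡ entry g b l → entry h a j ≡ entry h b l → a ≡ b × j ≡ l
  pair-injective {zero}  {zero}  g≢h _ _ = contradiction refl g≢h
  pair-injective {zero}  {suc s} _ {j = j} refl eq =
    row-inj (proj₁ (IsLatin.columns (latin s) j) eq) , refl
  pair-injective {suc s} {zero}  _ {j = j} eq refl =
    row-inj (proj₁ (IsLatin.columns (latin s) j) eq) , refl
  pair-injective {suc s} {suc u} g≢h eq₁ eq₂
    with eq₁ , eq₂ ← ,-injective (proj₁ (orthogonal s u (g≢h ∘ cong suc)) (cong₂ _,_ eq₁ eq₂))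
    = row-inj eq₁ , eq₂

  column-injective : ∀ g {a b} → entry g a (column a) ≡ entry g b (column b) → a ≡ b
  column-injective zero    = Unique-map⇒lookup-injective proj₂ columns
  column-injective (suc s) = Unique-map⇒lookup-injective (uncurry (square s)) (symbols s)

  k≤v : suc (suc (suc t)) ≤ suc (suc t) * n + ρ
  -- Split `k` as `(k - 1) + 1` and bound the summands by `(k - 1) * n` and `ρ`.
  k≤v = ≤-trans (≤-reflexive (+-comm 1 (suc (suc t))))
    (+-mono-≤ (m≤m*n (suc (suc t)) n {{>-nonZero 1≤n}}) 1≤ρ)

  maximal : ∃[ 𝒟 ] IsPacking ρ (suc (suc (suc t))) 𝒟 × length 𝒟 ≡ D ρ (suc (suc (suc t)))
  maximal = proj₁ (D-isMaximum ρ (suc (suc (suc t))))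

  -- The stem carries a packing attaining `D ρ k`, which supplies the second term of the block
  -- count.
  open Construction entry row-injective pair-injective (proj₁ (proj₂ maximal))
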